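{- $\mathbb{E}_{base}\cup\mathbb{E}_{models}\subsetneq\mathbb{E}_{Büchi}$.
   Context: Fix a finite nonempty $AP$. LTL formulae $\varphi::=\bot\mid p\mid\neg\varphi\mid\varphi\lor\varphi\mid X\varphi\mid\varphi U\varphi$ with standard semantics on traces in $(2^{AP})^\omega$. Kripke structures $M=(S,I,T,\lambda)$ (finite $S$, nonempty initial set $I$, left-total $T$, labelling $\lambda:S\to2^{AP}$); $M\models\varphi$ iff all traces of $M$ satisfy $\varphi$; $\mathrm{Cn}_{LTL}(X)$ = formulae satisfied by every Kripke structure satisfying all formulae of $X$. Büchi automata over $2^{AP}$ (accepting infinite words via runs visiting recurrence states infinitely often), $\mathcal{L}(A)$ the language, $\mathrm{supp}(A):=\{\varphi\mid\pi\models\varphi\ \forall\pi\in\mathcal{L}(A)\}$. Excerpts: $\mathbb{E}_{base}:=\{\mathrm{Cn}_{LTL}(X)\mid X\text{ finite set of LTL formulae}\}$; $\mathbb{E}_{models}:=\{\{\varphi\mid M\models\varphi\text{ for all }M\in X\}\mid X\text{ finite set of Kripke structures}\}$; $\mathbb{E}_{Büchi}:=\{\mathrm{supp}(A)\mid A\text{ a Büchi automaton over }2^{AP}\}$. -}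

module Defs where

open import Level using (0ℓ)
open import Data.Nat.Base using (ℕ; suc; _+_; _<_; _≤_)
open import Data.Fin.Base using (Fin)
open import Data.Fin.Subset using (Subset; Nonempty; _∈_)
open import Data.Empty using (⊥)
open import Data.List.Base using (List)
open import Data.List.Relation.Unary.All using (All)
open import Data.Product.Base using (_×_; Σ-syntax; ∃-syntax)
open import Data.Sum.Base using (_⊎_)
open import Relation.Nullary.Negation.Core using (¬_)
open import Relation.Unary using (Pred; _≐_)
open import Relation.Binary.PropositionalEquality.Core using (_≡_)

-- The finite set AP of atomic propositions is Fin n, so 2^AP is Subset n.

data Formula (n : ℕ) : Set where
  ⊥′   : Formula n
  atom : Fin n → Formula n
  ¬′_  : Formula n → Formula n
  _∨′_ : Formula n → Formula n → Formula n
  X_   : Formula n → Formula n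
  _U_  : Formula n → Formula n → Formula n

infix  8 ¬′_ X_
infixr 7 _U_
infixr 6 _∨′_

Trace : ℕ → Set
Trace n = ℕ → Subset n

suffix : ∀ {n} → ℕ → Trace n → Trace n
suffix i π j = π (i + j)

infix 4 _⊨_ _⊨ᴷ_

_⊨_ : ∀ {n} → Trace n → Formula n → Set
π ⊨ ⊥′       = ⊥
π ⊨ atom p   = p ∈ π 0
π ⊨ (¬′ φ)   = ¬ (π ⊨ φ)
π ⊨ (φ ∨′ ψ) = (π ⊨ φ) ⊎ (π ⊨ ψ)
π ⊨ (X φ)    = suffix 1 π ⊨ φ
π ⊨ (φ U ψ)  = ∃[ i ] (suffix i π ⊨ ψ) × (∀ j → j < i → suffix j π ⊨ φ)

-- States are numbered, so that Kripke structures live in Set rather than Set₁;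
-- every finite state set is of this form up to renaming.  The successors of s
-- under the transition relation T are the elements of step s.

record Kripke (n : ℕ) : Set where
  field
    size       : ℕ
    init       : Subset size
    init≢∅     : Nonempty init
    step       : Fin size → Subset size
    left-total : ∀ s → Nonempty (step s)
    label      : Fin size → Subset n

_IsTraceOf_ : ∀ {n} → Trace n → Kripke n → Set
π IsTraceOf M =
  Σ[ ρ ∈ (ℕ → Fin size) ] (ρ 0 ∈ init)
                        × (∀ i → ρ (suc i) ∈ step (ρ i))
                        × (∀ i → π i ≡ label (ρ i))
  where open Kripke M

_⊨ᴷ_ : ∀ {n} → Kripke n → Formula n → Set
M ⊨ᴷ φ = ∀ π → π IsTraceOf M → π ⊨ φ

-- The transition relation relates q, a and q′ iff q′ ∈ step q a.
-- There may be several initial states or none, so the language may be empty.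

record Büchi (n : ℕ) : Set where
  field
    size       : ℕ
    init       : Subset size
    step       : Fin size → Subset n → Subset size
    recurrence : Subset size

𝓛 : ∀ {n} → Büchi n → Pred (Trace n) 0ℓ
𝓛 A π =
  Σ[ ρ ∈ (ℕ → Fin size) ] (ρ 0 ∈ init)
                        × (∀ i → ρ (suc i) ∈ step (ρ i) (π i))
                        × (∀ i → ∃[ j ] i ≤ j × ρ j ∈ recurrence)
  where open Büchi A

FormulaSet : ℕ → Set₁
FormulaSet n = Pred (Formula n) 0ℓ

Cn : ∀ {n} → List (Formula n) → FormulaSet n
Cn Γ φ = ∀ M → All (M ⊨ᴷ_) Γ → M ⊨ᴷ φ

Th : ∀ {n} → List (Kripke n) → FormulaSet n
Th Ms φ = All (_⊨ᴷ φ) Ms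

supp : ∀ {n} → Büchi n → FormulaSet n
supp A φ = ∀ π → 𝓛 A π → π ⊨ φ

-- Finite sets are given by lists, and sets of formulae are compared by
-- extensional equality _≐_.

𝔼-base : ∀ n → Pred (FormulaSet n) 0ℓ
𝔼-base n K = ∃[ Γ ] K ≐ Cn Γ

𝔼-models : ∀ n → Pred (FormulaSet n) 0ℓ
𝔼-models n K = ∃[ Ms ] K ≐ Th Ms

𝔼-Büchi : ∀ n → Pred (FormulaSet n) 0ℓ
𝔼-Büchi n K = ∃[ A ] K ≐ supp A

{-# OPTIONS --safe #-}
-- The automaton of ⋀ Γ guesses the truth value of every subformula; its support is Cn Γ because
-- a nonempty Büchi language contains an ultimately periodic word, which is the only trace of
-- some Kripke structure.  A finite set of Kripke structures becomes a disjoint union of automata.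
--
-- For strictness, consider the words in which p fails exactly once, at an odd position.  Their
-- support contains Xⁱ p for all even i, yet a finite base whose consequences hold at ⊤ᵏ ⊥ ⊤^ω for
-- a large odd k also holds at ⊤ᵏ⁺¹ ⊥ ⊤^ω.  It contains "p fails eventually", but finitely many
-- Kripke structures satisfying this satisfy "p fails within N steps" for some N.

module Submission where

open import Defs
open import Level using (0ℓ)
open import Data.Nat.Base using (ℕ; NonZero)
open import Axiom.ExcludedMiddle using (ExcludedMiddle)
open import Relation.Unary using (_∪_; _⊂_)

open import Data.Bool.Base using (Bool; false; T)
import Data.Empty
open import Data.Fin.Base as Fin using (Fin; toℕ; fromℕ<)
open import Data.Fin.Patterns using (0F; 1F; 2F)
open import Data.Fin.Properties using (*↔×; +↔⊎; 1↔⊤; 2↔Bool; pigeonhole; toℕ-fromℕ<; fromℕ<-cong; toℕ<n)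
open import Data.Fin.Subset using (Subset; _∈_; ⁅_⁆; ⊤; ⊥)
open import Data.Fin.Subset.Properties using (∈⊤; ∉⊥; x∈⁅x⁆; x∈⁅y⁆⇒x≡y; _∈?_)
open import Data.List.Base using (List; []; _∷_)
open import Data.List.Relation.Unary.All as All using (All; []; _∷_)
open import Data.Nat.Base using (zero; suc; _+_; _*_; _⊔_; _≤_; _<_; z≤n; s≤s; s≤s⁻¹)
open import Data.Nat.Properties using (+-suc; +-identityʳ; +-assoc; _≟_; ≤-refl; ≤-trans; <-trans; ≤-<-trans; <⇒≤; <⇒≢; ≤∧≢⇒<; m≤n⇒m<n∨m≡n; m≤n⇒m≤1+n)
open import Data.Nat.Properties using (m≤m+n; m≤n+m; m≤m*n; m≤m⊔n; m≤n⊔m; m⊔n≤o⇒m≤o; m⊔n≤o⇒n≤o; anyUpTo?; m∸n+n≡m; m+[n∸m]≡n; n≤1+n; n<1+n)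
open import Data.Product.Base using (_×_; _,_; Σ-syntax; ∃-syntax; proj₁; proj₂)
open import Data.Product.Function.NonDependent.Propositional using (_×-⇔_; _×-↔_)
open import Data.Sum.Base using (_⊎_; inj₁; inj₂; [_,_]′)
open import Data.Sum.Function.Propositional using (_⊎-⇔_; _⊎-↔_)
open import Data.Sum.Relation.Binary.Pointwise using (Pointwise; inj₁; inj₂; drop-inj₁; drop-inj₂)
open import Data.Unit.Base as Unit using (tt)
open import Data.Vec.Base using (tabulate)
open import Data.Vec.Properties using ([]=⇒lookup; lookup⇒[]=; lookup∘tabulate)
open import Function.Base using (_∘_; id)
open import Function.Bundles using (_↔_; _⇔_; mk⇔; module Inverse; module Equivalence)
open import Function.Construct.Composition using (_⇔-∘_)
open import Function.Construct.Identity using (↔-id)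
open import Function.Properties.Inverse using (↔-trans)
open import Function.Related.TypeIsomorphisms using (¬-cong-⇔)
open import Relation.Binary.PropositionalEquality using (_≡_; _≢_; _≗_; refl; sym; trans; cong; subst; subst₂)
open import Relation.Nullary using (¬_; ¬?; yes; no; contradiction)
open import Relation.Nullary.Decidable using (⌊_⌋; decidable-stable; toWitness; fromWitness; does; dec-true)
import Function.Properties.Equivalence as ⇔

open Equivalence using (to; from)

-- Recurrence along the natural numbers.

InfinitelyOften : (ℕ → Set) → Set
InfinitelyOften P = ∀ i → ∃[ j ] i ≤ j × P j

infinitelyOften⇒offset : ∀ {P} → InfinitelyOften P → ∀ i → ∃[ d ] P (d + i)
infinitelyOften⇒offset {P} ∞P i with j , i≤j , p ← ∞P i = _ , subst P (sym (m∸n+n≡m i≤j)) p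

offset⇒infinitelyOften : ∀ {P} → (∀ i → ∃[ d ] P (d + i)) → InfinitelyOften P
offset⇒infinitelyOften f i with d , p ← f i = d + i , m≤n+m i d , p

infinitelyOften-suc : ∀ {P} → InfinitelyOften P → InfinitelyOften (P ∘ suc)
infinitelyOften-suc ∞P i with suc j , i<j , p ← ∞P (suc i) = j , s≤s⁻¹ i<j , p

-- Linear temporal logic

⊨-cong : ∀ {n} {π π′ : Trace n} (φ : Formula n) → π ≗ π′ → π ⊨ φ ⇔ π′ ⊨ φ
⊨-cong ⊥′ π≗π′ = ⇔.refl
⊨-cong (atom p) π≗π′ = mk⇔ (subst (p ∈_) (π≗π′ 0)) (subst (p ∈_) (sym (π≗π′ 0)))
⊨-cong (¬′ φ) π≗π′ = ¬-cong-⇔ (⊨-cong φ π≗π′)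
⊨-cong (φ ∨′ ψ) π≗π′ = ⊨-cong φ π≗π′ ⊎-⇔ ⊨-cong ψ π≗π′
⊨-cong (X φ) π≗π′ = ⊨-cong φ (π≗π′ ∘ suc)
⊨-cong (φ U ψ) π≗π′ = mk⇔
  (λ (i , s , f) → i , to (ψ-cong i) s , λ j j<i → to (φ-cong j) (f j j<i))
  (λ (i , s , f) → i , from (ψ-cong i) s , λ j j<i → from (φ-cong j) (f j j<i))
  where
  φ-cong = λ i → ⊨-cong φ (λ j → π≗π′ (i + j))
  ψ-cong = λ i → ⊨-cong ψ (λ j → π≗π′ (i + j))

suffix-suc : ∀ {n} (π : Trace n) i φ → suffix 1 (suffix i π) ⊨ φ ⇔ suffix (suc i) π ⊨ φ
suffix-suc π i φ = ⊨-cong φ (λ j → cong π (+-suc i j))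

suffix-+ : ∀ {n} (π : Trace n) i j φ → suffix j (suffix i π) ⊨ φ ⇔ suffix (i + j) π ⊨ φ
suffix-+ π i j φ = ⊨-cong φ (λ k → cong π (sym (+-assoc i j k)))

U-unfold : ∀ {n} (π : Trace n) φ ψ →
  π ⊨ φ U ψ ⇔ (π ⊨ ψ ⊎ π ⊨ φ × suffix 1 π ⊨ φ U ψ)
U-unfold π φ ψ = mk⇔
  (λ { (zero , s , f) → inj₁ s
     ; (suc i , s , f) → inj₂ (f 0 (s≤s z≤n) , i , s , λ j j<i → f (suc j) (s≤s j<i)) })
  (λ { (inj₁ s) → 0 , s , λ _ ()
     ; (inj₂ (t , i , s , f)) → suc i , s , λ { zero _ → t ; (suc j) j<i → f j (s≤s⁻¹ j<i) } })

-- Formulae about where `p` holds or fails.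

X^_∙_ : ∀ {n} → ℕ → Formula n → Formula n
X^ zero ∙ φ = φ
X^ suc i ∙ φ = X (X^ i ∙ φ)

X^-atom : ∀ {n} (π : Trace n) i p → π ⊨ X^ i ∙ atom p ⇔ p ∈ π i
X^-atom π zero p = ⇔.refl
X^-atom π (suc i) p = X^-atom (suffix 1 π) i p

_fails≤_ : ∀ {n} → Fin n → ℕ → Formula n
p fails≤ zero = ¬′ atom p
p fails≤ suc N = ¬′ atom p ∨′ X (p fails≤ N)

⊨-fails≤ : ∀ {n} (π : Trace n) p N → π ⊨ p fails≤ N ⇔ (∃[ i ] i ≤ N × ¬ p ∈ π i)
⊨-fails≤ π p zero = mk⇔ (λ p∉ → 0 , z≤n , p∉) (λ { (zero , _ , p∉) → p∉ })
⊨-fails≤ π p (suc N) = mk⇔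
  (λ { (inj₁ p∉) → 0 , z≤n , p∉
     ; (inj₂ s) → let i , i≤N , p∉ = to (⊨-fails≤ (suffix 1 π) p N) s in suc i , s≤s i≤N , p∉ })
  (λ { (zero , _ , p∉) → inj₁ p∉
     ; (suc i , i≤N , p∉) → inj₂ (from (⊨-fails≤ (suffix 1 π) p N) (i , s≤s⁻¹ i≤N , p∉)) })

fails : ∀ {n} → Fin n → Formula n
fails p = (¬′ ⊥′) U (¬′ atom p)

⊨-fails : ∀ {n} (π : Trace n) p → π ⊨ fails p ⇔ (∃[ i ] ¬ p ∈ π i)
⊨-fails π p = mk⇔
  (λ (i , s , _) → i , subst (λ k → ¬ p ∈ π k) (+-identityʳ i) s)
  (λ (i , p∉) → i , subst (λ k → ¬ p ∈ π k) (sym (+-identityʳ i)) p∉ , λ _ _ ())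

-- The sequence 0, 1, …, j − 1, i, i + 1, …, j − 1, i, …

module Loop {i j : ℕ} (i<j : i < j) where

  next : ℕ → ℕ
  next x with suc x ≟ j
  ... | yes _ = i
  ... | no  _ = suc x

  -- Carries a property of runs along the loop: only at the closing edge is `j` replaced by `i`, and
  -- there a run in the same state at both positions transfers it.
  next-elim : ∀ (P : ℕ → Set) x → P (suc x) → (P j → P i) → P (next x)
  next-elim P x p f with suc x ≟ j
  ... | yes refl = f p
  ... | no  _    = p

  next-< : ∀ {x} → x < j → next x < j
  next-< {x} x<j with suc x ≟ j
  ... | yes _ = i<j
  ... | no ≢j = ≤∧≢⇒< x<j ≢j

  loop : ℕ → ℕ
  loop zero = 0
  loop (suc k) = next (loop k)

  loop-< : ∀ k → loop k < j
  loop-< zero = ≤-<-trans z≤n i<j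
  loop-< (suc k) = next-< (loop-< k)

  -- The distance `d` from `suc (loop k)` to `j` shrinks with every step that does not close the
  -- loop, so the loop closes after finitely many steps.
  revisits : InfinitelyOften (λ k → loop k ≡ i)
  revisits k = search _ k (m+[n∸m]≡n (loop-< k))
    where
    search : ∀ d k → suc (loop k) + d ≡ j → ∃[ k′ ] k ≤ k′ × loop k′ ≡ i
    search d k eq with suc (loop k) ≟ j in p
    search d k eq | yes _ = suc k , n≤1+n k , returns
      where
      returns : loop (suc k) ≡ i
      returns rewrite p = refl
    search zero k eq | no ≢j = contradiction (trans (sym (+-identityʳ _)) eq) ≢j
    search (suc d) k eq | no ≢j =
      let k′ , k<k′ , e = search d (suc k) (trans (cong (λ x → suc x + d) advances) (trans (sym (+-suc _ d)) eq))
      in k′ , <⇒≤ k<k′ , e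
      where
      advances : loop (suc k) ≡ suc (loop k)
      advances rewrite p = refl

  -- The states are the positions below `j`. One initial state and one successor per state leave
  -- `π ∘ loop` as the only trace, up to pointwise equality.
  kripke : ∀ {n} → Trace n → Kripke n
  kripke π = record
    { size       = j
    ; init       = ⁅ fromℕ< (loop-< 0) ⁆
    ; init≢∅     = _ , x∈⁅x⁆ _
    ; step       = λ s → ⁅ fromℕ< (next-< (toℕ<n s)) ⁆
    ; left-total = λ s → _ , x∈⁅x⁆ _
    ; label      = π ∘ toℕ
    }

  loop-isTrace : ∀ {n} (π : Trace n) → (π ∘ loop) IsTraceOf kripke π
  loop-isTrace π =
      (λ k → fromℕ< (loop-< k))
    , x∈⁅x⁆ _
    , (λ k → subst (fromℕ< (loop-< (suc k)) ∈_) (cong ⁅_⁆ (step-loop k)) (x∈⁅x⁆ _))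
    , (λ k → cong π (sym (toℕ-fromℕ< (loop-< k))))
    where
    step-loop : ∀ k → fromℕ< (loop-< (suc k)) ≡ fromℕ< (next-< (toℕ<n (fromℕ< (loop-< k))))
    step-loop k = fromℕ<-cong _ _ (cong next (sym (toℕ-fromℕ< (loop-< k))))
                    (loop-< (suc k)) (next-< (toℕ<n (fromℕ< (loop-< k))))

  loop-unique : ∀ {n} (π : Trace n) σ → σ IsTraceOf kripke π → π ∘ loop ≗ σ
  loop-unique π σ (ρ , ρ-init , ρ-step , σ≡) k = trans (cong π (sym (states k))) (sym (σ≡ k))
    where
    states : ∀ k → toℕ (ρ k) ≡ loop k
    states zero = trans (cong toℕ (x∈⁅y⁆⇒x≡y (fromℕ< (loop-< 0)) ρ-init)) (toℕ-fromℕ< (loop-< 0))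
    states (suc k) = trans (cong toℕ (x∈⁅y⁆⇒x≡y (fromℕ< (next-< (toℕ<n (ρ k)))) (ρ-step k)))
                           (trans (toℕ-fromℕ< (next-< (toℕ<n (ρ k)))) (cong next (states k)))

-- Among `size + 1` successive visits to recurrence states, two are in the same state. Repeating the
-- segment between them forever gives a run that meets this state again and again. Uniqueness of the
-- trace lets what holds of one word hold of a whole structure.
lasso : ∀ {n} (A : Büchi n) {π} → 𝓛 A π →
  ∃[ M ] ∃[ π′ ] 𝓛 A π′ × π′ IsTraceOf M × (∀ σ → σ IsTraceOf M → π′ ≗ σ)
lasso A {π} (ρ , ρ-init , ρ-step , ρ-rec) = close (pigeonhole (n<1+n _) (ρ ∘ visit ∘ toℕ))
  where
  open Büchi A
  visit : ℕ → ℕ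
  visit zero = proj₁ (ρ-rec 0)
  visit (suc k) = proj₁ (ρ-rec (suc (visit k)))
  visit-rec : ∀ k → ρ (visit k) ∈ recurrence
  visit-rec zero = proj₂ (proj₂ (ρ-rec 0))
  visit-rec (suc k) = proj₂ (proj₂ (ρ-rec (suc (visit k))))
  visit-mono : ∀ {k l} → k < l → visit k < visit l
  visit-mono {k} {suc l} k<l with m≤n⇒m<n∨m≡n (s≤s⁻¹ k<l)
  ... | inj₁ k<l′ = <-trans (visit-mono k<l′) (proj₁ (proj₂ (ρ-rec _)))
  ... | inj₂ refl = proj₁ (proj₂ (ρ-rec _))
  close : (∃[ a ] ∃[ b ] a Fin.< b × ρ (visit (toℕ a)) ≡ ρ (visit (toℕ b))) → _
  close (a , b , a<b , eq) =
    kripke π , π ∘ loop , (ρ ∘ loop , ρ-init , loop-step , loop-rec) , loop-isTrace π , loop-unique π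
    where
    open Loop (visit-mono a<b)
    loop-step : ∀ k → ρ (loop (suc k)) ∈ step (ρ (loop k)) (π (loop k))
    loop-step k = next-elim (λ x → ρ x ∈ S) (loop k) (ρ-step _) (subst (_∈ S) (sym eq))
      where S = step (ρ (loop k)) (π (loop k))
    loop-rec : ∀ i → ∃[ j ] i ≤ j × ρ (loop j) ∈ recurrence
    loop-rec i with j , i≤j , e ← revisits i = j , i≤j , subst (λ x → ρ x ∈ recurrence) (sym e) (visit-rec (toℕ a))

-- Büchi automata with arbitrary finite state types

record Automaton (n : ℕ) : Set₁ where
  field
    State  : Set
    size   : ℕ
    finite : Fin size ↔ State
    Init   : State → Set
    Step   : State → Subset n → State → Set
    Rec    : State → Set

  FairRun : Trace n → (ℕ → State) → Set
  FairRun π ρ = (∀ i → Step (ρ i) (π i) (ρ (suc i))) × InfinitelyOften (Rec ∘ ρ)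

  Accepts : Trace n → Set
  Accepts π = ∃[ ρ ] Init (ρ 0) × FairRun π ρ

  fairRun-suc : ∀ {π ρ} → FairRun π ρ → FairRun (suffix 1 π) (ρ ∘ suc)
  fairRun-suc (steps , ∞rec) = steps ∘ suc , infinitelyOften-suc ∞rec

open Automaton using (FairRun; Accepts; fairRun-suc)

nowhere : ∀ {n} → Automaton n
nowhere = record
  { State = Fin 0 ; size = 0 ; finite = ↔-id _
  ; Init = λ () ; Step = λ () ; Rec = λ () }

_∪ᴬ_ : ∀ {n} → Automaton n → Automaton n → Automaton n
A ∪ᴬ B = record
  { State  = A.State ⊎ B.State
  ; size   = A.size + B.size
  ; finite = ↔-trans +↔⊎ (A.finite ⊎-↔ B.finite)
  ; Init   = [ A.Init , B.Init ]′
  ; Step   = λ s a s′ → Pointwise (λ q → A.Step q a) (λ q → B.Step q a) s s′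
  ; Rec    = [ A.Rec , B.Rec ]′
  }
  where
  module A = Automaton A
  module B = Automaton B

-- No step changes sides, so the side of the first state is that of the whole run.
accepts-∪ : ∀ {n} (A B : Automaton n) π → Accepts (A ∪ᴬ B) π ⇔ (Accepts A π ⊎ Accepts B π)
accepts-∪ A B π = mk⇔ split
  [ (λ (ρ , ρ-init , steps , ∞rec) → inj₁ ∘ ρ , ρ-init , inj₁ ∘ steps , ∞rec)
  , (λ (ρ , ρ-init , steps , ∞rec) → inj₂ ∘ ρ , ρ-init , inj₂ ∘ steps , ∞rec) ]′
  where
  module A = Automaton A
  module B = Automaton B
  module C = Automaton (A ∪ᴬ B)
  split : Accepts (A ∪ᴬ B) π → Accepts A π ⊎ Accepts B π
  split (ρ , ρ-init , steps , ∞rec) with ρ 0 in ρ0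
  ... | inj₁ q₀ = inj₁ (proj₁ ∘ left , ρ-init-left , left-steps , left-rec)
    where
    left : ∀ i → Σ[ q ∈ A.State ] ρ i ≡ inj₁ q
    left zero = q₀ , ρ0
    left (suc i) = stays (proj₂ (left i)) (steps i)
      where
      stays : ∀ {x y q} → x ≡ inj₁ q → C.Step x (π i) y → Σ[ q′ ∈ A.State ] y ≡ inj₁ q′
      stays refl (inj₁ _) = _ , refl
    ρ-init-left : A.Init q₀
    ρ-init-left = ρ-init
    left-steps : ∀ i → A.Step (proj₁ (left i)) (π i) (proj₁ (left (suc i)))
    left-steps i = drop-inj₁ (subst₂ (λ s → C.Step s (π i)) (proj₂ (left i)) (proj₂ (left (suc i))) (steps i))
    left-rec : InfinitelyOften (A.Rec ∘ proj₁ ∘ left)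
    left-rec i with j , i≤j , r ← ∞rec i = j , i≤j , subst C.Rec (proj₂ (left j)) r
  ... | inj₂ q₀ = inj₂ (proj₁ ∘ right , ρ-init-right , right-steps , right-rec)
    where
    right : ∀ i → Σ[ q ∈ B.State ] ρ i ≡ inj₂ q
    right zero = q₀ , ρ0
    right (suc i) = stays (proj₂ (right i)) (steps i)
      where
      stays : ∀ {x y q} → x ≡ inj₂ q → C.Step x (π i) y → Σ[ q′ ∈ B.State ] y ≡ inj₂ q′
      stays refl (inj₂ _) = _ , refl
    ρ-init-right : B.Init q₀
    ρ-init-right = ρ-init
    right-steps : ∀ i → B.Step (proj₁ (right i)) (π i) (proj₁ (right (suc i)))
    right-steps i = drop-inj₂ (subst₂ (λ s → C.Step s (π i)) (proj₂ (right i)) (proj₂ (right (suc i))) (steps i))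
    right-rec : InfinitelyOften (B.Rec ∘ proj₁ ∘ right)
    right-rec i with j , i≤j , r ← ∞rec i = j , i≤j , subst C.Rec (proj₂ (right j)) r

-- Kripke structures as automata.

ofKripke : ∀ {n} → Kripke n → Automaton n
ofKripke M = record
  { State  = Fin size
  ; size   = size
  ; finite = ↔-id _
  ; Init   = _∈ init
  ; Step   = λ s a s′ → a ≡ label s × s′ ∈ step s
  ; Rec    = λ _ → Unit.⊤
  }
  where open Kripke M

accepts-ofKripke : ∀ {n} (M : Kripke n) π → Accepts (ofKripke M) π ⇔ π IsTraceOf M
accepts-ofKripke M π = mk⇔
  (λ (ρ , ρ-init , steps , _) → ρ , ρ-init , proj₂ ∘ steps , proj₁ ∘ steps)
  (λ (ρ , ρ-init , steps , labels) →
    ρ , ρ-init , (λ i → labels i , steps i) , λ i → i , ≤-refl , tt)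

ofKripkes : ∀ {n} → List (Kripke n) → Automaton n
ofKripkes [] = nowhere
ofKripkes (M ∷ Ms) = ofKripke M ∪ᴬ ofKripkes Ms

Th-ofKripkes : ∀ {n} (Ms : List (Kripke n)) φ →
  Th Ms φ ⇔ (∀ π → Accepts (ofKripkes Ms) π → π ⊨ φ)
Th-ofKripkes [] φ = mk⇔ (λ _ π (ρ , _) → contradiction (ρ 0) λ ()) (λ _ → [])
Th-ofKripkes (M ∷ Ms) φ = mk⇔
  (λ { (m ∷ ms) π acc →
       [ m π ∘ to (accepts-ofKripke M π) , to (Th-ofKripkes Ms φ) ms π ]′
         (to (accepts-∪ (ofKripke M) (ofKripkes Ms) π) acc) })
  (λ h → (λ π tr → h π (from (accepts-∪ (ofKripke M) (ofKripkes Ms) π) (inj₁ (from (accepts-ofKripke M π) tr))))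
       ∷ from (Th-ofKripkes Ms φ) (λ π acc → h π (from (accepts-∪ (ofKripke M) (ofKripkes Ms) π) (inj₂ acc))))

⋀ : ∀ {n} → List (Formula n) → Formula n
⋀ [] = ¬′ ⊥′
⋀ (φ ∷ Γ) = ¬′ (¬′ φ ∨′ ¬′ ⋀ Γ)

-- The words ⊤ᵏ ⊥ ⊤^ω

w : ∀ {n} → ℕ → Trace n
w zero zero = ⊥
w zero (suc i) = ⊤
w (suc k) zero = ⊤
w (suc k) (suc i) = w k i

w-hole : ∀ {n} k {p : Fin n} → ¬ p ∈ w k k
w-hole zero = ∉⊥
w-hole (suc k) = w-hole k

w-full : ∀ {n} k {i} {p : Fin n} → i ≢ k → p ∈ w k i
w-full zero {zero} i≢k = contradiction refl i≢k
w-full zero {suc i} i≢k = ∈⊤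
w-full (suc k) {zero} i≢k = ∈⊤
w-full (suc k) {suc i} i≢k = w-full k (i≢k ∘ cong suc)

-- Bounds how late the failure must come for the formula not to notice its shift by one. An atom
-- inspects position 0 and costs one. `U` costs nothing beyond its arguments, by the expansion law.
depth : ∀ {n} → Formula n → ℕ
depth ⊥′ = 0
depth (atom p) = 1
depth (¬′ φ) = depth φ
depth (φ ∨′ ψ) = depth φ ⊔ depth ψ
depth (X φ) = suc (depth φ)
depth (φ U ψ) = depth φ ⊔ depth ψ

-- In the case of `U`, the word `w (suc k)` is `w k` with a letter in front, and the induction
-- hypotheses equate the arguments of `U` on the two words. One unfolding of `U` at `w (suc k)`
-- therefore leads to `w k` and back, without induction on `k`.
w-indistinguishable : ∀ {n} (φ : Formula n) {k} → depth φ ≤ k → w k ⊨ φ ⇔ w (suc k) ⊨ φ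
w-indistinguishable ⊥′ d≤k = ⇔.refl
w-indistinguishable (atom p) {suc k} d≤k = ⇔.refl
w-indistinguishable (¬′ φ) d≤k = ¬-cong-⇔ (w-indistinguishable φ d≤k)
w-indistinguishable (φ ∨′ ψ) d≤k =
  w-indistinguishable φ (m⊔n≤o⇒m≤o _ _ d≤k) ⊎-⇔ w-indistinguishable ψ (m⊔n≤o⇒n≤o _ _ d≤k)
w-indistinguishable (X φ) {suc k} d≤k = w-indistinguishable φ (s≤s⁻¹ d≤k)
w-indistinguishable (φ U ψ) {k} d≤k = mk⇔
  (λ u → from unfold ([ inj₁ ∘ to ψ-same , (λ (t , _) → inj₂ (to φ-same t , u)) ]′ (to (U-unfold (w k) φ ψ) u)))
  (λ u → [ (λ s → from (U-unfold (w k) φ ψ) (inj₁ (from ψ-same s))) , proj₂ ]′ (to unfold u))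
  where
  -- The suffix of w (suc k) at 1 is w k.
  unfold = U-unfold (w (suc k)) φ ψ
  φ-same = w-indistinguishable φ (m⊔n≤o⇒m≤o _ _ d≤k)
  ψ-same = w-indistinguishable ψ (m⊔n≤o⇒n≤o (depth φ) _ d≤k)

-- An automaton for the words with a single failure of p, at an odd position

pattern even = 0F
pattern odd  = 1F
pattern done = 2F

-- Before the failure the state holds the parity of the position. The failure is possible only from
-- `odd`, and it must happen because `done` alone is recurrent.
oddFailure : ∀ {n} → Fin n → Automaton n
oddFailure {n} p = record
  { State = Fin 3 ; size = 3 ; finite = ↔-id _
  ; Init = _≡ even ; Step = Step ; Rec = _≡ done }
  where
  Step : Fin 3 → Subset n → Fin 3 → Set
  Step even a s = p ∈ a × s ≡ odd
  Step odd  a s = p ∈ a × s ≡ even ⊎ ¬ p ∈ a × s ≡ done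
  Step done a s = p ∈ a × s ≡ done

accepts-w : ∀ {n} (p : Fin n) i → Accepts (oddFailure p) (w (suc (i * 2)))
accepts-w p i = state (suc (i * 2)) , start-even i , steps _ , recurs
  where
  -- `start k` is the state with `k` letters left before the failure, and `state k` is the run on
  -- `w k` from there.
  start : ℕ → Fin 3
  start zero = odd
  start (suc zero) = even
  start (suc (suc k)) = start k
  state : ℕ → ℕ → Fin 3
  state k zero = start k
  state zero (suc i) = done
  state (suc k) (suc i) = state k i
  start-even : ∀ i → start (suc (i * 2)) ≡ even
  start-even zero = refl
  start-even (suc i) = start-even i
  step-start : ∀ k → Automaton.Step (oddFailure p) (start (suc k)) ⊤ (start k)
  step-start zero = ∈⊤ , refl
  step-start (suc zero) = inj₁ (∈⊤ , refl)
  step-start (suc (suc k)) = step-start k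
  steps : ∀ k i → Automaton.Step (oddFailure p) (state k i) (w k i) (state k (suc i))
  steps zero zero = inj₂ (∉⊥ , refl)
  steps zero (suc i) = ∈⊤ , refl
  steps (suc k) zero = step-start k
  steps (suc k) (suc i) = steps k i
  state-done : ∀ k i → state k (suc (i + k)) ≡ done
  state-done zero i = refl
  state-done (suc k) i rewrite +-suc i k = state-done k i
  recurs : InfinitelyOften (λ j → state (suc (i * 2)) j ≡ done)
  recurs j = suc (j + suc (i * 2)) , m≤n⇒m≤1+n (m≤m+n j _) , state-done (suc (i * 2)) j

-- A run is never in `odd` at an even position, as two steps from another state lead to another such
-- state. Every step that leaves `even` or `done` reads `p`.
accepts⇒even-∈ : ∀ {n} (p : Fin n) {π} → Accepts (oddFailure p) π → ∀ i → p ∈ π (i * 2)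
accepts⇒even-∈ p {π} (ρ , ρ-init , steps , _) i = now (ρ (i * 2)) (not-odd i) (steps (i * 2))
  where
  open Automaton (oddFailure p) using (Step)
  now : ∀ s {a s′} → s ≢ odd → Step s a s′ → p ∈ a
  now even _ (p∈ , _) = p∈
  now odd ≢odd _ = contradiction refl ≢odd
  now done _ (p∈ , _) = p∈
  twice : ∀ s {a s′ b s″} → s ≢ odd → Step s a s′ → Step s′ b s″ → s″ ≢ odd
  twice even _ (_ , refl) (inj₁ (_ , refl)) ()
  twice even _ (_ , refl) (inj₂ (_ , refl)) ()
  twice odd ≢odd _ _ = contradiction refl ≢odd
  twice done _ (_ , refl) (_ , refl) ()
  not-odd : ∀ i → ρ (i * 2) ≢ odd
  not-odd zero eq = contradiction (trans (sym ρ-init) eq) λ ()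
  not-odd (suc i) = twice (ρ (i * 2)) (not-odd i) (steps _) (steps _)

-- A visit to `done` is traced back to the step that entered it, which reads a failure.
accepts⇒fails : ∀ {n} (p : Fin n) {π} → Accepts (oddFailure p) π → ∃[ i ] ¬ p ∈ π i
accepts⇒fails p {π} (ρ , ρ-init , steps , ∞rec) with j , _ , ρj ← ∞rec 0 = search j ρj
  where
  search : ∀ j → ρ j ≡ done → ∃[ i ] ¬ p ∈ π i
  search zero ρ0 = contradiction (trans (sym ρ-init) ρ0) λ ()
  search (suc j) ρsj with ρ j in ρj | steps j
  ... | even | _ , eq = contradiction (trans (sym eq) ρsj) λ ()
  ... | odd  | inj₁ (_ , eq) = contradiction (trans (sym eq) ρsj) λ ()
  ... | odd  | inj₂ (p∉ , _) = j , p∉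
  ... | done | _ = search j ρj

-- A run on which p persists for longer than the number of states
-- can be closed to a loop on which p never fails.
kripke-fails-early : ∀ {n} (p : Fin n) (M : Kripke n) → M ⊨ᴷ fails p → M ⊨ᴷ p fails≤ Kripke.size M
kripke-fails-early p M m π (ρ , ρ-init , steps , labels)
  with anyUpTo? (λ i → ¬? (p ∈? π i)) (suc (Kripke.size M))
... | yes (i , i≤s , p∉) = from (⊨-fails≤ π p _) (i , s≤s⁻¹ i≤s , p∉)
... | no none = contradiction (pigeonhole (n<1+n size) (ρ ∘ toℕ)) unrepeated
  where
  open Kripke M
  unrepeated : ¬ (∃[ a ] ∃[ b ] a Fin.< b × ρ (toℕ a) ≡ ρ (toℕ b))
  unrepeated (a , b , a<b , eq) =
    let i , p∉ = to (⊨-fails (π ∘ loop) p) (m (π ∘ loop) (ρ ∘ loop , ρ-init , loop-step , labels ∘ loop))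
    -- The failure on the loop is a failure of `π` at `loop i`, which lies below `b` and so within
    -- the range already searched.
    in none (loop i , <-trans (loop-< i) (toℕ<n b) , p∉)
    where
    open Loop a<b
    loop-step : ∀ k → ρ (loop (suc k)) ∈ step (ρ (loop k))
    loop-step k = next-elim (λ x → ρ x ∈ step (ρ (loop k))) (loop k) (steps _)
      (subst (_∈ step (ρ (loop k))) (sym eq))

fails≤-mono : ∀ {n} (p : Fin n) (π : Trace n) {M N} → M ≤ N → π ⊨ p fails≤ M → π ⊨ p fails≤ N
fails≤-mono p π M≤N s =
  let i , i≤M , p∉ = to (⊨-fails≤ π p _) s in from (⊨-fails≤ π p _) (i , ≤-trans i≤M M≤N , p∉)

Th-fails-early : ∀ {n} (p : Fin n) (Ms : List (Kripke n)) → Th Ms (fails p) → ∃[ N ] Th Ms (p fails≤ N)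
Th-fails-early p [] [] = 0 , []
Th-fails-early p (M ∷ Ms) (m ∷ ms) =
  let N , th = Th-fails-early p Ms ms
  in Kripke.size M ⊔ N
   , (λ π tr → fails≤-mono p π (m≤m⊔n (Kripke.size M) N) (kripke-fails-early p M m π tr))
   ∷ All.map (λ h π tr → fails≤-mono p π (m≤n⊔m (Kripke.size M) N) (h π tr)) th

-- Classical reasoning: predicates as subsets, and automata with numbered states.

module _ (em : ExcludedMiddle 0ℓ) where

  truth : Set → Bool
  truth P = ⌊ em {P} ⌋

  T-truth : ∀ {P} → T (truth P) ⇔ P
  T-truth = mk⇔ toWitness fromWitness

  comprehension : ∀ {m} → (Fin m → Set) → Subset m
  comprehension P = tabulate (λ x → does (em {P x}))

  ∈-comprehension : ∀ {m} (P : Fin m → Set) {x} → x ∈ comprehension P ⇔ P x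
  ∈-comprehension P {x} = mk⇔ here⇒ ⇒here
    where
    here⇒ : x ∈ comprehension P → P x
    here⇒ x∈ with em {P x} | trans (sym (lookup∘tabulate (λ y → does (em {P y})) x)) ([]=⇒lookup x∈)
    ... | yes p | _ = p
    ⇒here : P x → x ∈ comprehension P
    ⇒here p = lookup⇒[]= x _ (trans (lookup∘tabulate (λ y → does (em {P y})) x) (dec-true em p))

  toBüchi : ∀ {n} → Automaton n → Büchi n
  toBüchi A = record
    { size       = size
    ; init       = comprehension (Init ∘ decode)
    ; step       = λ s a → comprehension (Step (decode s) a ∘ decode)
    ; recurrence = comprehension (Rec ∘ decode)
    }
    where
    open Automaton A
    decode = Inverse.to finite

  𝓛-toBüchi : ∀ {n} (A : Automaton n) π → 𝓛 (toBüchi A) π ⇔ Accepts A π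
  𝓛-toBüchi A π = mk⇔
    (λ (ρ , ρ-init , steps , ∞rec) →
        decode ∘ ρ
      , to (∈-comprehension _) ρ-init
      , (λ i → to (∈-comprehension _) (steps i))
      , λ i → let j , i≤j , r = ∞rec i in j , i≤j , to (∈-comprehension _) r)
    (λ (ρ , ρ-init , steps , ∞rec) →
        encode ∘ ρ
      , from (∈-comprehension _) (subst Init (sym (decode-encode (ρ 0))) ρ-init)
      , (λ i → from (∈-comprehension _)
          (subst₂ (λ s → Step s (π i)) (sym (decode-encode (ρ i))) (sym (decode-encode (ρ (suc i)))) (steps i)))
      , λ i → let j , i≤j , r = ∞rec i in
          j , i≤j , from (∈-comprehension _) (subst Rec (sym (decode-encode (ρ j))) r))
    where
    open Automaton A
    decode = Inverse.to finite
    encode = Inverse.from finite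
    decode-encode : ∀ q → decode (encode q) ≡ q
    decode-encode q = Inverse.inverseˡ finite refl

  -- Conjunction of two recurrence conditions

  -- M remembers that P has occurred since the last time that Q was met with M set.
  Remembers : (M P Q : ℕ → Set) → Set
  Remembers M P Q = ∀ i → M (suc i) ⇔ (M i × ¬ Q i ⊎ ¬ M i × P i)

  -- The bit persists up to the first `Q`, which therefore meets it set.
  remembered-met : ∀ {M P Q} → Remembers M P Q → ∀ j → M 0 → Q j → ∃[ k ] M k × Q k
  remembered-met R zero m q = 0 , m , q
  remembered-met {Q = Q} R (suc j) m q with em {Q 0}
  ... | yes q₀ = 0 , m , q₀
  ... | no ¬q₀ = let k , r = remembered-met (R ∘ suc) j (from (R 0) (inj₁ (m , ¬q₀))) q in suc k , r

  -- Either the bit is set by time `j`, or `P` sets it there.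
  remembered-after : ∀ {M P Q} → Remembers M P Q → ∀ j → P j → ∃[ k ] M k
  remembered-after {M} R j p with em {M 0}
  ... | yes m = 0 , m
  remembered-after R zero p | no ¬m = 1 , from (R 0) (inj₂ (¬m , p))
  remembered-after R (suc j) p | no ¬m = let k , m = remembered-after (R ∘ suc) j p in suc k , m

  remembered-since : ∀ {M P Q} → Remembers M P Q → ∀ j → ¬ M 0 → M j → ∃[ k ] P k
  remembered-since R zero ¬m m = contradiction m ¬m
  remembered-since {P = P} R (suc j) ¬m m with em {P 0}
  ... | yes p = 0 , p
  ... | no ¬p =
    let k , p = remembered-since (R ∘ suc) j ([ ¬m ∘ proj₁ , ¬p ∘ proj₂ ]′ ∘ to (R 0)) m in suc k , p

  -- A meeting of `Q` with the bit clears it, so `P` must occur before the next meeting. Conversely,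
  -- a recurring `P` keeps setting the bit, and the next `Q` meets it.
  remembers-∞ : ∀ {M P Q} → Remembers M P Q →
    InfinitelyOften (λ i → M i × Q i) ⇔ (InfinitelyOften P × InfinitelyOften Q)
  remembers-∞ {M} {P} {Q} R = mk⇔
    (λ ∞MQ → offset⇒infinitelyOften {P} (P-recurs (infinitelyOften⇒offset ∞MQ))
           , λ i → let j , i≤j , _ , q = ∞MQ i in j , i≤j , q)
    (λ (∞P , ∞Q) → offset⇒infinitelyOften
      (MQ-recurs (infinitelyOften⇒offset ∞P) (infinitelyOften⇒offset ∞Q)))
    where
    from-offset : ∀ i → Remembers (λ k → M (k + i)) (λ k → P (k + i)) (λ k → Q (k + i))
    from-offset i k = R (k + i)

    P-recurs : (∀ i → ∃[ d ] M (d + i) × Q (d + i)) → ∀ i → ∃[ d ] P (d + i)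
    P-recurs f i with d , m , q ← f i with e , m′ , _ ← f (suc d + i)
      with k , p ← remembered-since (from-offset (suc d + i)) e
                     -- The bit is clear right after the meeting at `d + i`, yet set at the later
                     -- meeting.
                     ([ (λ (_ , ¬q) → ¬q q) , (λ (¬m , _) → ¬m m) ]′ ∘ to (R (d + i))) m′
      = k + suc d , subst P (sym (+-assoc k (suc d) i)) p

    MQ-recurs : (∀ i → ∃[ d ] P (d + i)) → (∀ i → ∃[ d ] Q (d + i)) → ∀ i → ∃[ d ] M (d + i) × Q (d + i)
    MQ-recurs f g i with d , p ← f i with k , m ← remembered-after (from-offset i) d p
      with e , q ← g (k + i) with l , r ← remembered-met (from-offset (k + i)) e m q
      = l + k , subst (λ x → M x × Q x) (sym (+-assoc l k i)) r

  memory : (P Q : ℕ → Set) → ℕ → Bool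
  memory P Q zero = false
  memory P Q (suc i) = truth (T (memory P Q i) × ¬ Q i ⊎ ¬ T (memory P Q i) × P i)

  -- Degeneralization: with the bit in the state, `Rec` and `Q` become a single Büchi condition.
  _∧∞_ : ∀ {n} (A : Automaton n) → (Automaton.State A → Set) → Automaton n
  A ∧∞ Q = record
    { State  = State × Bool
    ; size   = size * 2
    ; finite = ↔-trans *↔× (finite ×-↔ 2↔Bool)
    ; Init   = Init ∘ proj₁
    ; Step   = λ (s , m) a (s′ , m′) → Step s a s′ × (T m′ ⇔ (T m × ¬ Q s ⊎ ¬ T m × Rec s))
    ; Rec    = λ (s , m) → T m × Q s
    }
    where open Automaton A

  fairRun-∧∞ : ∀ {n} (A : Automaton n) Q {π ρ} → FairRun (A ∧∞ Q) π ρ →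
    FairRun A π (proj₁ ∘ ρ) × InfinitelyOften (Q ∘ proj₁ ∘ ρ)
  fairRun-∧∞ A Q (steps , ∞rec) =
    let ∞P , ∞Q = to (remembers-∞ (proj₂ ∘ steps)) ∞rec in (proj₁ ∘ steps , ∞P) , ∞Q

  ∧∞-fairRun : ∀ {n} (A : Automaton n) Q {π ρ} → FairRun A π ρ → InfinitelyOften (Q ∘ ρ) →
    Σ[ m ∈ (ℕ → Bool) ] FairRun (A ∧∞ Q) π (λ i → ρ i , m i)
  ∧∞-fairRun A Q {ρ = ρ} (steps , ∞rec) ∞Q =
    memory P (Q ∘ ρ) , (λ i → steps i , T-truth) , from (remembers-∞ (λ i → T-truth)) (∞rec , ∞Q)
    where P = Automaton.Rec A ∘ ρ

  -- Automata for formulae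

  -- On fair runs Init s tells, at every time, whether φ holds.
  record _Tests_ {n} (A : Automaton n) (φ : Formula n) : Set where
    open Automaton A using (Init)
    field
      run   : ∀ π → ∃[ ρ ] FairRun A π ρ
      sound : ∀ {π ρ} → FairRun A π ρ → Init (ρ 0) ⇔ π ⊨ φ

    sound-at : ∀ {π ρ} i → FairRun A π ρ → Init (ρ i) ⇔ suffix i π ⊨ φ
    sound-at zero r = sound r
    sound-at (suc i) r = sound-at i (fairRun-suc A r)

  open _Tests_

  ⊥ᴬ : ∀ {n} → Automaton n
  ⊥ᴬ = record
    { State = Unit.⊤ ; size = 1 ; finite = 1↔⊤
    ; Init = λ _ → Data.Empty.⊥ ; Step = λ _ _ _ → Unit.⊤ ; Rec = λ _ → Unit.⊤ }

  ⊥ᴬ-tests : ∀ {n} → ⊥ᴬ {n} Tests ⊥′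
  ⊥ᴬ-tests = record
    { run   = λ π → _ , _ , λ i → i , ≤-refl , tt
    ; sound = λ _ → ⇔.refl
    }

  -- The state guesses the truth value before the letter that settles it is read; the step checks
  -- the guess.
  atomᴬ : ∀ {n} → Fin n → Automaton n
  atomᴬ p = record
    { State = Bool ; size = 2 ; finite = 2↔Bool
    ; Init = T ; Step = λ b a _ → T b ⇔ p ∈ a ; Rec = λ _ → Unit.⊤ }

  atomᴬ-tests : ∀ {n} (p : Fin n) → atomᴬ p Tests atom p
  atomᴬ-tests p = record
    { run   = λ π → (λ i → truth (p ∈ π i)) , (λ i → T-truth) , λ i → i , ≤-refl , tt
    ; sound = λ (steps , _) → steps 0
    }

  -- Complementing `Init` suffices because every word has a fair run and every fair run decides the
  -- formula correctly either way.
  ¬ᴬ_ : ∀ {n} → Automaton n → Automaton n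
  ¬ᴬ A = record { Automaton A ; Init = ¬_ ∘ Automaton.Init A }

  ¬ᴬ-tests : ∀ {n} {A : Automaton n} {φ} → A Tests φ → (¬ᴬ A) Tests (¬′ φ)
  ¬ᴬ-tests A-φ = record { run = run A-φ ; sound = λ r → ¬-cong-⇔ (sound A-φ r) }

  -- Only the recurrence of `A` is imposed here; `_∨ᴬ_` adds that of `B` through `_∧∞_`.
  _∥_ : ∀ {n} → Automaton n → Automaton n → Automaton n
  A ∥ B = record
    { State  = A.State × B.State
    ; size   = A.size * B.size
    ; finite = ↔-trans *↔× (A.finite ×-↔ B.finite)
    ; Init   = λ (s , t) → A.Init s ⊎ B.Init t
    ; Step   = λ (s , t) a (s′ , t′) → A.Step s a s′ × B.Step t a t′
    ; Rec    = A.Rec ∘ proj₁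
    }
    where
    module A = Automaton A
    module B = Automaton B

  _∨ᴬ_ : ∀ {n} → Automaton n → Automaton n → Automaton n
  A ∨ᴬ B = (A ∥ B) ∧∞ (Automaton.Rec B ∘ proj₂)

  ∨ᴬ-tests : ∀ {n} {A B : Automaton n} {φ ψ} → A Tests φ → B Tests ψ → (A ∨ᴬ B) Tests (φ ∨′ ψ)
  ∨ᴬ-tests {A = A} {B} A-φ B-ψ = record
    { run   = λ π →
        let _ , stepsA , ∞A = run A-φ π
            _ , stepsB , ∞B = run B-ψ π
        in _ , proj₂ (∧∞-fairRun (A ∥ B) (Automaton.Rec B ∘ proj₂) ((λ i → stepsA i , stepsB i) , ∞A) ∞B)
    ; sound = λ r →
        let (steps , ∞A) , ∞B = fairRun-∧∞ (A ∥ B) (Automaton.Rec B ∘ proj₂) r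
        in sound A-φ (proj₁ ∘ steps , ∞A) ⊎-⇔ sound B-ψ (proj₂ ∘ steps , ∞B)
    }

  -- The bit predicts the verdict of `A` at the next position.
  Xᴬ_ : ∀ {n} → Automaton n → Automaton n
  Xᴬ A = record
    { State  = State × Bool
    ; size   = size * 2
    ; finite = ↔-trans *↔× (finite ×-↔ 2↔Bool)
    ; Init   = T ∘ proj₂
    ; Step   = λ (s , b) a (s′ , _) → Step s a s′ × (T b ⇔ Init s′)
    ; Rec    = Rec ∘ proj₁
    }
    where open Automaton A

  Xᴬ-tests : ∀ {n} {A : Automaton n} {φ} → A Tests φ → (Xᴬ A) Tests (X φ)
  Xᴬ-tests {A = A} A-φ = record
    { run   = λ π → let ρ , steps , ∞rec = run A-φ π in
        (λ i → ρ i , truth (Automaton.Init A (ρ (suc i)))) , (λ i → steps i , T-truth) , ∞rec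
    ; sound = λ (steps , ∞rec) →
        sound A-φ (fairRun-suc A (proj₁ ∘ steps , ∞rec)) ⇔-∘ proj₂ (steps 0)
    }

  -- The bit guesses the truth of the until formula, and each step enforces the expansion law. That
  -- law alone also permits a guess that is never fulfilled; the recurrence conditions added in
  -- `_Uᴬ_` rule it out.
  guessUntil : ∀ {n} → Automaton n → Automaton n → Automaton n
  guessUntil A B = record
    { State  = (A.State × B.State) × Bool
    ; size   = A.size * B.size * 2
    ; finite = ↔-trans *↔× (↔-trans *↔× (A.finite ×-↔ B.finite) ×-↔ 2↔Bool)
    ; Init   = T ∘ proj₂
    ; Step   = λ ((s , t) , b) a ((s′ , t′) , b′) →
        (A.Step s a s′ × B.Step t a t′) × (T b ⇔ (B.Init t ⊎ A.Init s × T b′))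
    ; Rec    = A.Rec ∘ proj₁ ∘ proj₁
    }
    where
    module A = Automaton A
    module B = Automaton B

  module _ {n} (A B : Automaton n) where
    open Automaton

    recurs₂ : State (guessUntil A B) → Set
    recurs₂ ((s , t) , b) = Rec B t

    -- Recurrence of this condition excludes runs that postpone a guessed U forever.
    unpostponed : State (guessUntil A B ∧∞ recurs₂) → Set
    unpostponed (((s , t) , b) , _) = T b → Init B t

    _Uᴬ_ : Automaton n
    _Uᴬ_ = (guessUntil A B ∧∞ recurs₂) ∧∞ unpostponed

  Uᴬ-tests : ∀ {n} {A B : Automaton n} {φ ψ} → A Tests φ → B Tests ψ → (A Uᴬ B) Tests (φ U ψ)
  Uᴬ-tests {n} {A} {B} {φ} {ψ} A-φ B-ψ = record { run = complete ; sound = fair-sound }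
    where
    module A = Automaton A
    module B = Automaton B
    Guesses : (ℕ → A.State) → (ℕ → B.State) → (ℕ → Bool) → Set
    Guesses ρ σ b = ∀ i → T (b i) ⇔ (B.Init (σ i) ⊎ A.Init (ρ i) × T (b (suc i)))

    -- Induction on a position `j` where the guess is either off or fulfilled: up to there, the
    -- expansion law yields `φ` at each position or `ψ` at once.
    correct : ∀ {π ρ σ b} → FairRun A π ρ → FairRun B π σ → Guesses ρ σ b →
      ∀ j → (T (b j) → B.Init (σ j)) → T (b 0) → π ⊨ φ U ψ
    correct {π} rA rB g zero ful b₀ = from (U-unfold π φ ψ) (inj₁ (to (sound B-ψ rB) (ful b₀)))
    correct {π} rA rB g (suc j) ful b₀ with to (g 0) b₀
    ... | inj₁ now = from (U-unfold π φ ψ) (inj₁ (to (sound B-ψ rB) now))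
    ... | inj₂ (now , b₁) = from (U-unfold π φ ψ) (inj₂
      (to (sound A-φ rA) now , correct (fairRun-suc A rA) (fairRun-suc B rB) (g ∘ suc) j ful b₁))

    guessed : ∀ {π ρ σ b} → FairRun A π ρ → FairRun B π σ → Guesses ρ σ b →
      ∀ k → suffix k π ⊨ ψ → (∀ j → j < k → suffix j π ⊨ φ) → T (b 0)
    guessed rA rB g zero s f = from (g 0) (inj₁ (from (sound B-ψ rB) s))
    guessed rA rB g (suc k) s f = from (g 0) (inj₂
      ( from (sound A-φ rA) (f 0 (s≤s z≤n))
      , guessed (fairRun-suc A rA) (fairRun-suc B rB) (g ∘ suc) k s (λ j j<k → f (suc j) (s≤s j<k))))

    fair-sound : ∀ {π ρ} → FairRun (A Uᴬ B) π ρ → T (proj₂ (proj₁ (proj₁ (ρ 0)))) ⇔ π ⊨ φ U ψ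
    fair-sound {π} {ρ} r
      with r′ , ∞fulfilled ← fairRun-∧∞ (guessUntil A B ∧∞ recurs₂ A B) (unpostponed A B) r
      with (steps , ∞A) , ∞B ← fairRun-∧∞ (guessUntil A B) (recurs₂ A B) r′
      with j , _ , fulfilled ← ∞fulfilled 0
      = mk⇔ (correct {b = b} runA runB guesses j fulfilled)
            (λ (k , s , f) → guessed {b = b} runA runB guesses k s f)
      where
      b : ℕ → Bool
      b = proj₂ ∘ proj₁ ∘ proj₁ ∘ ρ
      runA : FairRun A π (proj₁ ∘ proj₁ ∘ proj₁ ∘ proj₁ ∘ ρ)
      runA = proj₁ ∘ proj₁ ∘ steps , ∞A
      runB : FairRun B π (proj₂ ∘ proj₁ ∘ proj₁ ∘ proj₁ ∘ ρ)
      runB = proj₂ ∘ proj₁ ∘ steps , ∞B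
      guesses : Guesses (proj₁ ∘ proj₁ ∘ proj₁ ∘ proj₁ ∘ ρ) (proj₂ ∘ proj₁ ∘ proj₁ ∘ proj₁ ∘ ρ) b
      guesses = proj₂ ∘ steps

    complete : ∀ π → ∃[ ρ ] FairRun (A Uᴬ B) π ρ
    complete π with ρ , rA ← run A-φ π | σ , rB ← run B-ψ π = _ , proj₂ run₂
      where
      b : ℕ → Bool
      b i = truth (suffix i π ⊨ φ U ψ)
      guesses : Guesses ρ σ b
      guesses i =
        ⇔.sym (sound-at B-ψ i rB ⊎-⇔ (sound-at A-φ i rA ×-⇔ (⇔.sym (suffix-suc π i (φ U ψ)) ⇔-∘ T-truth)))
        ⇔-∘ (U-unfold (suffix i π) φ ψ ⇔-∘ T-truth)
      ∞fulfilled : InfinitelyOften (λ i → T (b i) → B.Init (σ i))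
      -- If the until formula holds at `i`, its witness is a position where `ψ` fulfils the guess.
      -- If not, the guess at `i` is off.
      ∞fulfilled i with em {suffix i π ⊨ φ U ψ}
      ... | yes (k , s , _) = i + k , m≤m+n i k , λ _ → from (sound-at B-ψ (i + k) rB) (to (suffix-+ π i k ψ) s)
      ... | no ¬u = i , ≤-refl , λ u → contradiction (to T-truth u) ¬u
      run₁ = ∧∞-fairRun (guessUntil A B) (recurs₂ A B)
        {ρ = λ i → (ρ i , σ i) , b i} ((λ i → (proj₁ rA i , proj₁ rB i) , guesses i) , proj₂ rA) (proj₂ rB)
      run₂ = ∧∞-fairRun (guessUntil A B ∧∞ recurs₂ A B) (unpostponed A B)
        (proj₂ run₁) ∞fulfilled

  tester : ∀ {n} → Formula n → Automaton n
  tester ⊥′ = ⊥ᴬ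
  tester (atom p) = atomᴬ p
  tester (¬′ φ) = ¬ᴬ tester φ
  tester (φ ∨′ ψ) = tester φ ∨ᴬ tester ψ
  tester (X φ) = Xᴬ tester φ
  tester (φ U ψ) = tester φ Uᴬ tester ψ

  tester-tests : ∀ {n} (φ : Formula n) → tester φ Tests φ
  tester-tests ⊥′ = ⊥ᴬ-tests
  tester-tests (atom p) = atomᴬ-tests p
  tester-tests (¬′ φ) = ¬ᴬ-tests (tester-tests φ)
  tester-tests (φ ∨′ ψ) = ∨ᴬ-tests (tester-tests φ) (tester-tests ψ)
  tester-tests (X φ) = Xᴬ-tests (tester-tests φ)
  tester-tests (φ U ψ) = Uᴬ-tests (tester-tests φ) (tester-tests ψ)

  accepts-tester : ∀ {n} (φ : Formula n) π → Accepts (tester φ) π ⇔ π ⊨ φ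
  accepts-tester φ π = mk⇔
    (λ (ρ , ρ-init , r) → to (sound (tester-tests φ) r) ρ-init)
    (λ s → let ρ , r = run (tester-tests φ) π in ρ , from (sound (tester-tests φ) r) s , r)

  𝓛-tester : ∀ {n} (φ : Formula n) π → 𝓛 (toBüchi (tester φ)) π ⇔ π ⊨ φ
  𝓛-tester φ π = accepts-tester φ π ⇔-∘ 𝓛-toBüchi (tester φ) π

  -- Finite bases and finite sets of models as Büchi automata.

  ⊨-⋀ : ∀ {n} (π : Trace n) Γ → π ⊨ ⋀ Γ ⇔ All (π ⊨_) Γ
  ⊨-⋀ π [] = mk⇔ (λ _ → []) (λ _ → id)
  ⊨-⋀ π (φ ∷ Γ) = mk⇔
    (λ h → decidable-stable em (h ∘ inj₁) ∷ to (⊨-⋀ π Γ) (decidable-stable em (h ∘ inj₂)))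
    (λ { (s ∷ ss) (inj₁ ¬s) → ¬s s ; (s ∷ ss) (inj₂ ¬ss) → ¬ss (from (⊨-⋀ π Γ) ss) })

  -- Finite model property: the tester accepts an ultimately periodic word, which is the only trace
  -- of some structure.
  satisfiable-by-Kripke : ∀ {n} (φ : Formula n) {π} → π ⊨ φ →
    ∃[ M ] M ⊨ᴷ φ × (∃[ σ ] σ IsTraceOf M)
  satisfiable-by-Kripke φ {π} s =
    let M , π′ , π′∈ , tr , unique = lasso (toBüchi (tester φ)) (from (𝓛-tester φ π) s)
    in M , (λ σ σ-tr → to (⊨-cong φ (unique σ σ-tr)) (to (𝓛-tester φ π′) π′∈)) , π′ , tr

  -- A word satisfying `Γ` but not `φ` would yield a structure that satisfies `Γ` and `¬′ φ` and has
  -- a trace, against `Cn Γ φ`.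
  Cn⇔traces : ∀ {n} (Γ : List (Formula n)) φ → Cn Γ φ ⇔ (∀ π → All (π ⊨_) Γ → π ⊨ φ)
  Cn⇔traces Γ φ = mk⇔
    (λ cn π ss → decidable-stable em (λ ¬s →
      let M , m , σ , tr = satisfiable-by-Kripke (⋀ (¬′ φ ∷ Γ)) (from (⊨-⋀ π (¬′ φ ∷ Γ)) (¬s ∷ ss))
          all σ tr = to (⊨-⋀ σ (¬′ φ ∷ Γ)) (m σ tr)
      in All.head (all σ tr) (cn M (All.tabulate (λ ψ∈Γ σ′ tr′ → All.lookup (All.tail (all σ′ tr′)) ψ∈Γ)) σ tr)))
    (λ h M ms π tr → h π (All.map (λ m → m π tr) ms))

  base⊆Büchi : ∀ {n K} → 𝔼-base n K → 𝔼-Büchi n K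
  base⊆Büchi {K = K} (Γ , K⊆ , ⊆K) =
      toBüchi (tester (⋀ Γ))
    , (λ {φ} k π π∈ → to (Cn⇔traces Γ φ) (K⊆ k) π (to (⊨-⋀ π Γ) (to (𝓛-tester (⋀ Γ) π) π∈)))
    , (λ {φ} s → ⊆K (from (Cn⇔traces Γ φ) (λ π ss → s π (from (𝓛-tester (⋀ Γ) π) (from (⊨-⋀ π Γ) ss)))))

  models⊆Büchi : ∀ {n K} → 𝔼-models n K → 𝔼-Büchi n K
  models⊆Büchi {K = K} (Ms , K⊆ , ⊆K) =
      toBüchi (ofKripkes Ms)
    , (λ {φ} k π π∈ → to (Th-ofKripkes Ms φ) (K⊆ k) π (to (𝓛-toBüchi (ofKripkes Ms) π) π∈))
    , (λ {φ} s → ⊆K (from (Th-ofKripkes Ms φ) (λ π acc → s π (from (𝓛-toBüchi (ofKripkes Ms) π) acc))))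

  -- Strictness.

  separating : ∀ {n} → Fin n → Büchi n
  separating p = toBüchi (oddFailure p)

  w∈separating : ∀ {n} (p : Fin n) i → 𝓛 (separating p) (w (suc (i * 2)))
  w∈separating p i = from (𝓛-toBüchi (oddFailure p) _) (accepts-w p i)

  separating∉base : ∀ {n} (p : Fin n) → ¬ 𝔼-base n (supp (separating p))
  separating∉base p (Γ , ⊆Cn , Cn⊆) =
    w-hole (suc d * 2) (to (X^-atom (w (suc d * 2)) (suc d * 2) p) (consequence (w (suc d * 2)) Γ-next))
    where
    d = depth (⋀ Γ)
    -- The position is even, so accepted words have `p` there, whereas `w (suc d * 2)` fails `p`
    -- exactly there.
    φ = X^ (suc d * 2) ∙ atom p
    even-∈ : supp (separating p) φ
    even-∈ π π∈ = from (X^-atom π (suc d * 2) p) (accepts⇒even-∈ p (to (𝓛-toBüchi (oddFailure p) π) π∈) (suc d))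
    consequence : ∀ π → All (π ⊨_) Γ → π ⊨ φ
    consequence = to (Cn⇔traces Γ φ) (⊆Cn {φ} even-∈)
    Γ-here : All (w (suc (d * 2)) ⊨_) Γ
    Γ-here = All.tabulate (λ {ψ} ψ∈Γ →
      Cn⊆ {ψ} (λ M ms → All.lookup ms ψ∈Γ) (w (suc (d * 2))) (w∈separating p d))
    -- `suc d * 2` is the successor of `suc (d * 2)`, which is at least the depth `d`, so the shift
    -- of the failure goes unnoticed by `Γ`.
    Γ-next : All (w (suc d * 2) ⊨_) Γ
    Γ-next = to (⊨-⋀ _ Γ) (to (w-indistinguishable (⋀ Γ) (m≤n⇒m≤1+n (m≤m*n d 2))) (from (⊨-⋀ _ Γ) Γ-here))

  separating∉models : ∀ {n} (p : Fin n) → ¬ 𝔼-models n (supp (separating p))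
  separating∉models p (Ms , ⊆Th , Th⊆) = p∉ (w-full _ (<⇒≢ (s≤s (≤-trans i≤N (m≤m*n N 2)))))
    where
    always-fails : supp (separating p) (fails p)
    always-fails π π∈ = from (⊨-fails π p) (accepts⇒fails p (to (𝓛-toBüchi (oddFailure p) π) π∈))
    early = Th-fails-early p Ms (⊆Th {fails p} always-fails)
    -- The accepted word `w (suc (N * 2))` fails `p` only after position `N`.
    N = proj₁ early
    failure = to (⊨-fails≤ (w (suc (N * 2))) p N) (Th⊆ {p fails≤ N} (proj₂ early) (w (suc (N * 2))) (w∈separating p N))
    i≤N = proj₁ (proj₂ failure)
    p∉ = proj₂ (proj₂ failure)

mainTheorem15 : ExcludedMiddle 0ℓ → (n : ℕ) → .{{_ : NonZero n}} →
    (𝔼-base n ∪ 𝔼-models n) ⊂ 𝔼-Büchi n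
mainTheorem15 em (suc n) =
    [ base⊆Büchi em , models⊆Büchi em ]′
  , λ Büchi⊆ → [ separating∉base em 0F , separating∉models em 0F ]′ (Büchi⊆ (separating em 0F , id , id))
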